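{- For any graph $G$, there exists a set $D\subseteq V(G)$ with $\partial_s(D)=\partial_s(G)$ which is a dominating set of $G$.
   Context: Graphs are finite, simple, undirected, with non-empty vertex set; $N(v)$ is the open neighbourhood of $v$. For $D\subseteq V(G)$: $N_e(D)=\{u\in V(G)\setminus D:\ N(u)\cap D\ne\varnothing\}$; for $v\in D$, $\mathrm{epn}(v,D)=\{u\in V(G)\setminus D:\ N(u)\cap D=\{v\}\}$; $D_w=\{v\in D:\ \mathrm{epn}(v,D)\neq\varnothing\}$. The strong differential of $D$ is $\partial_s(D)=|N_e(D)|-|D_w|$, and the strong differential of $G$ is $\partial_s(G)=\max\{\partial_s(D):\ D\subseteq V(G)\}$. A set $S\subseteq V(G)$ is a dominating set if $N(v)\cap S\neq\varnothing$ for every $v\in V(G)\setminus S$. -}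

module Defs where

open import Data.Bool.Properties using () renaming (_≟_ to _≟ᵇ_)
open import Data.Fin.Base using (Fin)
open import Data.Fin.Subset
  using (Subset; Nonempty; inside; outside; ⊥; ⁅_⁆; _∈_; _∉_; _∩_; ∣_∣)
open import Data.Fin.Subset.Properties using (_∈?_; nonempty?)
open import Data.Integer.Base using (ℤ; +_; _-_)
open import Data.Integer.Properties using (≤-totalOrder)
open import Data.List.Base using (List; []; _∷_; _++_; map)
open import Data.List.Extrema ≤-totalOrder using (max)
open import Data.List.Membership.Propositional using () renaming (_∈_ to _∈ˡ_)
open import Data.List.Membership.Propositional.Properties
  using (∈-++⁺ˡ; ∈-++⁺ʳ; ∈-map⁺)
open import Data.List.Relation.Unary.Any using (here)
open import Data.Nat.Base using (ℕ; zero; suc; NonZero)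
open import Data.Vec.Base as Vec using (tabulate)
open import Data.Vec.Properties using (≡-dec)
open import Function.Base using (_∘_)
open import Level using (0ℓ)
open import Relation.Binary.Core using (Rel)
open import Relation.Binary.Definitions using (Decidable; DecidableEquality; Symmetric)
open import Relation.Binary.PropositionalEquality.Core using (_≡_; refl)
open import Relation.Nullary.Decidable.Core using (does; ¬?; _×-dec_)
open import Relation.Nullary.Negation.Core using (¬_)
import Relation.Unary as U

comprehension : ∀ {n} {P : U.Pred (Fin n) 0ℓ} → U.Decidable P → Subset n
comprehension P? = tabulate (does ∘ P?)

_≟ˢ_ : ∀ {n} → DecidableEquality (Subset n)
_≟ˢ_ = ≡-dec _≟ᵇ_

subsets : ∀ n → List (Subset n)
subsets zero    = Vec.[] ∷ []
subsets (suc n) = map (outside Vec.∷_) (subsets n) ++ map (inside Vec.∷_) (subsets n)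

∈-subsets : ∀ {n} (p : Subset n) → p ∈ˡ subsets n
∈-subsets Vec.[]              = here refl
∈-subsets (outside Vec.∷ p)   = ∈-++⁺ˡ (∈-map⁺ (outside Vec.∷_) (∈-subsets p))
∈-subsets {suc n} (inside Vec.∷ p) =
  ∈-++⁺ʳ (map (outside Vec.∷_) (subsets n)) (∈-map⁺ (inside Vec.∷_) (∈-subsets p))

-- A finite simple graph, its vertices being numbered 0, …, order − 1.
record Graph : Set₁ where
  field
    order       : ℕ
    {{nonEmpty}} : NonZero order
    Adj         : Rel (Fin order) 0ℓ
    adj?        : Decidable Adj
    symmetric   : Symmetric Adj
    irreflexive : ∀ v → ¬ Adj v v

  Vertex : Set
  Vertex = Fin order

  VertexSet : Set
  VertexSet = Subset order

module _ (G : Graph) where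
  open Graph G

  N : Vertex → VertexSet
  N v = comprehension (adj? v)

  Nₑ : VertexSet → VertexSet
  Nₑ D = comprehension λ u → ¬? (u ∈? D) ×-dec nonempty? (N u ∩ D)

  -- Only meaningful for v ∈ D; Dʷ below restricts to such v.
  epn : Vertex → VertexSet → VertexSet
  epn v D = comprehension λ u → ¬? (u ∈? D) ×-dec ((N u ∩ D) ≟ˢ ⁅ v ⁆)

  Dʷ : VertexSet → VertexSet
  Dʷ D = comprehension λ v → (v ∈? D) ×-dec nonempty? (epn v D)

  -- The strong differential ∂ₛ(D) of a vertex set; the difference is taken in ℤ.
  ∂ₛ : VertexSet → ℤ
  ∂ₛ D = + ∣ Nₑ D ∣ - + ∣ Dʷ D ∣

  -- The strong differential ∂ₛ(G).  The first argument of max is its value on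
  -- the empty list; being ∂ₛ(∅), it does not affect the maximum.
  ∂ₛ-graph : ℤ
  ∂ₛ-graph = max (∂ₛ ⊥) (map ∂ₛ (subsets order))

  Dominating : VertexSet → Set
  Dominating S = ∀ v → v ∉ S → Nonempty (N v ∩ S)

-- If D attains the maximum, so does D′ = V ∖ Nₑ(D), that is, D together with the
-- vertices it does not dominate.  Every u ∉ D′ has a neighbour in D ⊆ D′; hence D′ is
-- dominating and Nₑ(D) ⊆ Nₑ(D′), and N(u) ∩ D′ = {v} forces N(u) ∩ D = {v}, so that
-- D′_w ⊆ D_w.
module Submission where

open import Defs
open import Data.Fin.Base using (Fin)
open import Data.Fin.Subset using (Subset; _∈_; _∉_; _⊆_; _∩_; ⁅_⁆; ∁; Nonempty; ⊥)
open import Data.Fin.Subset.Properties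
open import Data.Integer.Base using (+≤+; _≤_)
import Data.Integer.Properties as ℤ
open import Data.List.Base using (map)
open import Data.List.Extrema ℤ.≤-totalOrder using (argmax-sel; xs≤max)
open import Data.List.Membership.Propositional.Properties using (∈-map⁺; ∈-map⁻)
import Data.List.Relation.Unary.All as All
open import Data.Product using (_×_; Σ-syntax; _,_; proj₁; proj₂)
open import Data.Sum using (inj₁; inj₂)
open import Data.Vec.Properties using ([]=⇒lookup; lookup⇒[]=; lookup∘tabulate)
open import Function.Base using (id; _∘_)
open import Level using (0ℓ)
open import Relation.Binary.PropositionalEquality using (_≡_; sym; trans; subst)
open import Relation.Nullary.Decidable using (does; dec-true; yes; no; ¬?; _×-dec_)
open import Relation.Unary using (Pred; Decidable)

module _ {n} {P : Pred (Fin n) 0ℓ} (P? : Decidable P) where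

  ∈-comprehension⁺ : ∀ {x} → P x → x ∈ comprehension P?
  ∈-comprehension⁺ {x} px =
    lookup⇒[]= x _ (trans (lookup∘tabulate (does ∘ P?) x) (dec-true (P? x) px))

  ∈-comprehension⁻ : ∀ {x} → x ∈ comprehension P? → P x
  ∈-comprehension⁻ {x} x∈
    -- Abstracting `P? x` makes the second equation `does (P? x) ≡ true`, which is absurd in the
    -- `no` case.
    with P? x | trans (sym (lookup∘tabulate (does ∘ P?) x)) ([]=⇒lookup x∈)
  ... | yes px | _ = px
  ... | no _   | ()

-- The given element `y` must be `x`, and so must any `z` in the singleton; hence `z` is `y` and
-- lies in `p`.
nonempty-⊆⁅⁆ : ∀ {n} {p : Subset n} {x} → Nonempty p → p ⊆ ⁅ x ⁆ → p ≡ ⁅ x ⁆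
nonempty-⊆⁅⁆ {p = p} (y , y∈p) p⊆⁅x⁆ = ⊆-antisym p⊆⁅x⁆ λ z∈⁅x⁆ →
  subst (_∈ p) (trans (x∈⁅y⁆⇒x≡y _ (p⊆⁅x⁆ y∈p)) (sym (x∈⁅y⁆⇒x≡y _ z∈⁅x⁆))) y∈p

∩-monoʳ-⊆ : ∀ {n} (p : Subset n) {q r} → q ⊆ r → p ∩ q ⊆ p ∩ r
∩-monoʳ-⊆ p {q} q⊆r x∈ = let x∈p , x∈q = x∈p∩q⁻ p q x∈ in x∈p∩q⁺ (x∈p , q⊆r x∈q)

module _ (G : Graph) where
  open Graph G

  -- This decider and the next two repeat those inside the comprehensions of `Nₑ`, `epn` and `Dʷ`,
  -- so that membership there unfolds by definition.
  Nₑ? : ∀ D → Decidable (λ u → u ∉ D × Nonempty (N G u ∩ D))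
  Nₑ? D u = ¬? (u ∈? D) ×-dec nonempty? (N G u ∩ D)

  epn? : ∀ v D → Decidable (λ u → u ∉ D × N G u ∩ D ≡ ⁅ v ⁆)
  epn? v D u = ¬? (u ∈? D) ×-dec ((N G u ∩ D) ≟ˢ ⁅ v ⁆)

  Dʷ? : ∀ D → Decidable (λ v → v ∈ D × Nonempty (epn G v D))
  Dʷ? D v = (v ∈? D) ×-dec nonempty? (epn G v D)

  ∈-Nₑ⁺ : ∀ {u D} → u ∉ D → Nonempty (N G u ∩ D) → u ∈ Nₑ G D
  ∈-Nₑ⁺ {D = D} u∉D ne = ∈-comprehension⁺ (Nₑ? D) (u∉D , ne)

  ∈-Nₑ⁻ : ∀ {u D} → u ∈ Nₑ G D → u ∉ D × Nonempty (N G u ∩ D)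
  ∈-Nₑ⁻ {D = D} = ∈-comprehension⁻ (Nₑ? D)

  ∈-epn⁺ : ∀ {u v D} → u ∉ D → N G u ∩ D ≡ ⁅ v ⁆ → u ∈ epn G v D
  ∈-epn⁺ {v = v} {D = D} u∉D eq = ∈-comprehension⁺ (epn? v D) (u∉D , eq)

  ∈-epn⁻ : ∀ {u v D} → u ∈ epn G v D → u ∉ D × N G u ∩ D ≡ ⁅ v ⁆
  ∈-epn⁻ {v = v} {D = D} = ∈-comprehension⁻ (epn? v D)

  ∈-Dʷ⁺ : ∀ {v D} → v ∈ D → Nonempty (epn G v D) → v ∈ Dʷ G D
  ∈-Dʷ⁺ {D = D} v∈D ne = ∈-comprehension⁺ (Dʷ? D) (v∈D , ne)

  ∈-Dʷ⁻ : ∀ {v D} → v ∈ Dʷ G D → v ∈ D × Nonempty (epn G v D)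
  ∈-Dʷ⁻ {D = D} = ∈-comprehension⁻ (Dʷ? D)

  ∂ₛ-mono : ∀ {D E} → Nₑ G D ⊆ Nₑ G E → Dʷ G E ⊆ Dʷ G D → ∂ₛ G D ≤ ∂ₛ G E
  ∂ₛ-mono Nₑ⊆ Dʷ⊇ = ℤ.+-mono-≤ (+≤+ (p⊆q⇒∣p∣≤∣q∣ Nₑ⊆)) (ℤ.neg-mono-≤ (+≤+ (p⊆q⇒∣p∣≤∣q∣ Dʷ⊇)))

  ∂ₛ≤∂ₛ-graph : ∀ D → ∂ₛ G D ≤ ∂ₛ-graph G
  ∂ₛ≤∂ₛ-graph D = All.lookup (xs≤max _ _) (∈-map⁺ (∂ₛ G) (∈-subsets D))

  ∂ₛ-graph-attained : Σ[ D ∈ VertexSet ] ∂ₛ-graph G ≡ ∂ₛ G D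
  ∂ₛ-graph-attained with argmax-sel id (∂ₛ G ⊥) (map (∂ₛ G) (subsets order))
  -- The default value of `max` is itself the differential of the empty set, so this case also has a
  -- witness.
  ... | inj₁ eq  = ⊥ , eq
  ... | inj₂ max∈ = let D , _ , eq = ∈-map⁻ (∂ₛ G) max∈ in D , eq

  module _ (D : VertexSet) where

    D⊆∁Nₑ : D ⊆ ∁ (Nₑ G D)
    D⊆∁Nₑ v∈D = x∉p⇒x∈∁p λ v∈Nₑ → proj₁ (∈-Nₑ⁻ v∈Nₑ) v∈D

    N∩D⊆N∩∁Nₑ : ∀ u → N G u ∩ D ⊆ N G u ∩ ∁ (Nₑ G D)
    N∩D⊆N∩∁Nₑ u = ∩-monoʳ-⊆ (N G u) D⊆∁Nₑ

    ∁Nₑ-dominating : Dominating G (∁ (Nₑ G D))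
    ∁Nₑ-dominating u u∉ =
      let _ , w , w∈ = ∈-Nₑ⁻ (x∉∁p⇒x∈p u∉) in w , N∩D⊆N∩∁Nₑ u w∈

    -- Every vertex outside a dominating set lies in its `Nₑ`; here the outside is `Nₑ G D`.
    Nₑ⊆Nₑ-∁Nₑ : Nₑ G D ⊆ Nₑ G (∁ (Nₑ G D))
    Nₑ⊆Nₑ-∁Nₑ u∈ = ∈-Nₑ⁺ (x∈p⇒x∉∁p u∈) (∁Nₑ-dominating _ (x∈p⇒x∉∁p u∈))

    Dʷ-∁Nₑ⊆Dʷ : Dʷ G (∁ (Nₑ G D)) ⊆ Dʷ G D
    Dʷ-∁Nₑ⊆Dʷ {v} v∈ with _ , u , u∈epn ← ∈-Dʷ⁻ v∈
                     with u∉ , N∩≡⁅v⁆ ← ∈-epn⁻ u∈epn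
                     with u∉D , ne ← ∈-Nₑ⁻ (x∉∁p⇒x∈p u∉) =
      -- The same `u` stays an external private neighbour of `v` when the set shrinks to `D`.
      ∈-Dʷ⁺ v∈D (u , ∈-epn⁺ u∉D N∩D≡⁅v⁆)
      where
      N∩D≡⁅v⁆ : N G u ∩ D ≡ ⁅ v ⁆
      N∩D≡⁅v⁆ = nonempty-⊆⁅⁆ ne (subst (N G u ∩ D ⊆_) N∩≡⁅v⁆ (N∩D⊆N∩∁Nₑ u))

      -- A priori `v` could be one of the added vertices; it lies in `D` because `N G u ∩ D` is
      -- exactly `⁅ v ⁆`.
      v∈D : v ∈ D
      v∈D = proj₂ (x∈p∩q⁻ (N G u) D (subst (v ∈_) (sym N∩D≡⁅v⁆) (x∈⁅x⁆ v)))

    ∂ₛ≤∂ₛ-∁Nₑ : ∂ₛ G D ≤ ∂ₛ G (∁ (Nₑ G D))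
    ∂ₛ≤∂ₛ-∁Nₑ = ∂ₛ-mono Nₑ⊆Nₑ-∁Nₑ Dʷ-∁Nₑ⊆Dʷ

lemma3p1 : (G : Graph) →
    Σ[ D ∈ Graph.VertexSet G ] (∂ₛ G D ≡ ∂ₛ-graph G × Dominating G D)
lemma3p1 G =
  let D , max≡∂ₛD = ∂ₛ-graph-attained G
      D′          = ∁ (Nₑ G D)
  in D′
   -- The upper bound holds for any set; the lower one uses that `D` attains the maximum.
   , ℤ.≤-antisym (∂ₛ≤∂ₛ-graph G D′) (subst (_≤ ∂ₛ G D′) (sym max≡∂ₛD) (∂ₛ≤∂ₛ-∁Nₑ G D))
   , ∁Nₑ-dominating G D
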